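{- There exist infinitely many pairwise non-isomorphic graphs $G$ that contain $K_{3,3}$ as a subgraph and satisfy $\mathrm{mad}(G)=3$, $\Delta(G)=4$, and $\mathrm{lc}(G)>\lceil\Delta(G)/2\rceil+2$.
   Context: Graphs are finite and simple; $\Delta(G)$ is the maximum degree. A linear coloring of $G$ is a proper vertex coloring such that the subgraph induced by the union of each pair of color classes is a linear forest, i.e. a disjoint union of paths (a single vertex counts as a path). The linear chromatic number $\mathrm{lc}(G)$ is the smallest $k$ such that $G$ has a linear coloring with $k$ colors. The maximum average degree is $\mathrm{mad}(G)=\max_{H\subseteq G}\frac{2|E(H)|}{|V(H)|}$, over all nonempty subgraphs $H$ of $G$. -}

module Defs where

open import Data.Empty using (⊥)
open import Data.Fin using (Fin; toℕ; _≟_; _<?_)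
open import Data.Integer using (+_)
open import Data.List using (List; length; map; filter; allFin; cartesianProduct)
open import Data.List.Extrema.Nat using (max)
open import Data.Nat as ℕ using (ℕ; suc; _*_)
open import Data.Nat.Properties using (1+n≢n)
open import Data.Product using (Σ; ∃-syntax; _×_; _,_)
open import Data.Rational as ℚ using (ℚ; _/_)
open import Data.Refinement using (Refinement-syntax; value)
open import Data.Sum as Sum using (_⊎_; inj₁; inj₂)
open import Data.Unit using (⊤; tt)
open import Function.Bundles using (Inverse; Injection; _↔_; _↣_; _⇔_)
open import Level using (0ℓ)
open import Relation.Binary.Core using (Rel)
open import Relation.Binary.Definitions using (Symmetric; Irreflexive; Decidable)
open import Relation.Binary.PropositionalEquality using (_≡_; _≢_; refl)
open import Relation.Nullary using (yes; no)
open import Relation.Nullary.Decidable using (_×-dec_; _⊎-dec_; map′)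

-- A simple graph on the vertex set V.  Finite graphs are those on Fin n, and
-- adjacency is decidable so that their vertices and edges can be counted.
record Graph (V : Set) : Set₁ where
  infix 4 _~_ _~?_
  field
    _~_      : Rel V 0ℓ
    _~?_     : Decidable _~_
    ~-sym    : Symmetric _~_
    ~-irrefl : Irreflexive _≡_ _~_

open Graph public using () renaming (_~_ to Adj; _~?_ to adj?)

infix 4 _≅_ _⊑_

record _≅_ {V W : Set} (G : Graph V) (H : Graph W) : Set where
  field
    vertices : V ↔ W
    edges    : ∀ u v → Adj G u v ⇔ Adj H (Inverse.to vertices u) (Inverse.to vertices v)

-- H ⊑ G : H is isomorphic to a (not necessarily induced) subgraph of G.
record _⊑_ {W V : Set} (H : Graph W) (G : Graph V) : Set where
  field
    vertices : W ↣ V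
    edges    : ∀ u v → Adj H u v → Adj G (Injection.to vertices u) (Injection.to vertices v)

-- Membership in the vertex set of the induced subgraph is proof irrelevant, so
-- each vertex satisfying P occurs in it exactly once.
induced : {V : Set} → Graph V → (P : V → Set) → Graph [ v ∈ V ∣ P v ]
induced G P = record
  { _~_      = λ u v → Adj G (value u) (value v)
  ; _~?_     = λ u v → adj? G (value u) (value v)
  ; ~-sym    = Graph.~-sym G
  ; ~-irrefl = λ { refl → Graph.~-irrefl G refl }
  }

-- Path n has n vertices.
Path : (n : ℕ) → Graph (Fin n)
Path n = record
  { _~_      = λ i j → suc (toℕ i) ≡ toℕ j ⊎ suc (toℕ j) ≡ toℕ i
  ; _~?_     = λ i j → (suc (toℕ i) ℕ.≟ toℕ j) ⊎-dec (suc (toℕ j) ℕ.≟ toℕ i)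
  ; ~-sym    = Sum.swap
  ; ~-irrefl = λ { refl (inj₁ e) → 1+n≢n e ; refl (inj₂ e) → 1+n≢n e }
  }

data ⨆-Adj {m : ℕ} {W : Fin m → Set} (G : ∀ i → Graph (W i)) : Rel (Σ (Fin m) W) 0ℓ where
  within : ∀ {i x y} → Adj (G i) x y → ⨆-Adj G (i , x) (i , y)

-- Disjoint union of a finite family of graphs.
⨆ : {m : ℕ} {W : Fin m → Set} → (∀ i → Graph (W i)) → Graph (Σ (Fin m) W)
⨆ {m} {W} G = record
  { _~_      = ⨆-Adj G
  ; _~?_     = dec
  ; ~-sym    = λ { (within a) → within (Graph.~-sym (G _) a) }
  ; ~-irrefl = λ { refl (within a) → Graph.~-irrefl (G _) refl a }
  }
  where
  dec : Decidable (⨆-Adj G)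
  dec (i , x) (j , y) with i ≟ j
  ... | yes refl = map′ within (λ { (within a) → a }) (adj? (G i) x y)
  ... | no  i≢j  = no λ { (within _) → i≢j refl }

K : (m n : ℕ) → Graph (Fin m ⊎ Fin n)
K m n = record
  { _~_      = _~_
  ; _~?_     = dec
  ; ~-sym    = λ {u} {v} → symm u v
  ; ~-irrefl = λ { {inj₁ _} refl () ; {inj₂ _} refl () }
  }
  where
  _~_ : Rel (Fin m ⊎ Fin n) 0ℓ
  inj₁ _ ~ inj₁ _ = ⊥
  inj₁ _ ~ inj₂ _ = ⊤
  inj₂ _ ~ inj₁ _ = ⊤
  inj₂ _ ~ inj₂ _ = ⊥

  dec : Decidable _~_
  dec (inj₁ _) (inj₁ _) = no λ ()
  dec (inj₁ _) (inj₂ _) = yes tt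
  dec (inj₂ _) (inj₁ _) = yes tt
  dec (inj₂ _) (inj₂ _) = no λ ()

  symm : ∀ u v → u ~ v → v ~ u
  symm (inj₁ _) (inj₂ _) _ = tt
  symm (inj₂ _) (inj₁ _) _ = tt

-- A disjoint union of m paths, the i-th having suc (ℓ i) ≥ 1 vertices.
LinearForest : {V : Set} → Graph V → Set
LinearForest G = ∃[ m ] Σ (Fin m → ℕ) λ ℓ → G ≅ ⨆ (λ i → Path (suc (ℓ i)))

record LinearColoring {V : Set} (G : Graph V) (k : ℕ) : Set where
  field
    color  : V → Fin k
    proper : ∀ u v → Adj G u v → color u ≢ color v
    linear : ∀ a b → a ≢ b → LinearForest (induced G (λ v → color v ≡ a ⊎ color v ≡ b))

-- lc(G) = k
IsLinearChromaticNumber : {V : Set} → Graph V → ℕ → Set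
IsLinearChromaticNumber G k = LinearColoring G k × (∀ j → LinearColoring G j → k ℕ.≤ j)

module _ {n : ℕ} (G : Graph (Fin n)) where

  degree : Fin n → ℕ
  degree v = length (filter (adj? G v) (allFin n))

  Δ : ℕ
  Δ = max 0 (map degree (allFin n))

  -- Each edge is listed once, with its smaller endpoint first.
  edgeList : List (Fin n × Fin n)
  edgeList = filter (λ (u , v) → (u <? v) ×-dec adj? G u v)
                    (cartesianProduct (allFin n) (allFin n))

  ∣E∣ : ℕ
  ∣E∣ = length edgeList

averageDegree : {n : ℕ} → Graph (Fin (suc n)) → ℚ
averageDegree {n} H = + (2 * ∣E∣ H) / suc n

-- mad(G) = q: q is the maximum of 2|E(H)|/|V(H)| over the nonempty subgraphs H
-- of G.  As this ratio is invariant under isomorphism, H ranges over the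
-- nonempty graphs on the sets Fin (suc k) that are isomorphic to a subgraph of G.
IsMad : {V : Set} → Graph V → ℚ → Set₁
IsMad G q =
    (∃[ k ] Σ (Graph (Fin (suc k))) λ H → H ⊑ G × averageDegree H ≡ q)
  × (∀ {k} (H : Graph (Fin (suc k))) → H ⊑ G → averageDegree H ℚ.≤ q)

{-# OPTIONS --safe #-}
-- K₃,₃ has linear chromatic number 5: a linear forest contains neither a 4-cycle
-- nor a claw, so in a linear coloring at most one side repeats a color, and no
-- side is monochromatic.  Its average degree is 3, and attaching vertices of
-- degree at most 1 never creates a denser subgraph.  Hence K₃,₃ with one pendant
-- vertex (which makes Δ = 4) and any number of isolated vertices will do.
module Submission where

open import Defs
open import Data.Bool using (Bool; true; false; if_then_else_)
open import Data.Bool.Properties using (if-float)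
open import Data.Empty using (⊥; ⊥-elim)
open import Data.Fin as Fin using (Fin; zero; suc; toℕ; combine; remQuot; splitAt; join; _≟_)
open import Data.Fin.Patterns
import Data.Fin.Permutation as Permutation
open import Data.Fin.Properties using
  (¬Fin0; all?; any?; toℕ-injective; suc-injective; <-cmp; injective⇒≤; combine-injective; combine-remQuot; join-splitAt)
open import Data.Integer as ℤ using (+_)
import Data.Integer.Properties as ℤ
open import Data.List as List using (List; []; _∷_; length; lookup; map; filter; allFin; tabulate)
open import Data.List.Extrema.Nat using (max≈v⁺)
open import Data.List.Membership.Propositional.Properties using (∈-lookup; ∈-map⁺; ∈-allFin)
open import Data.List.Properties using (map-tabulate)
open import Data.List.Relation.Unary.All as All using (All)
import Data.List.Relation.Unary.All.Properties as All
open import Data.List.Relation.Unary.AllPairs using (_∷_)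
open import Data.List.Relation.Unary.Unique.Propositional using (Unique)
import Data.List.Relation.Unary.Unique.Propositional.Properties as Unique
open import Data.Nat as ℕ using (ℕ; zero; suc; _+_; _*_; _>_; _≤_; z≤n; s≤s; ⌈_/2⌉)
import Data.Nat.Properties as ℕ
open import Data.Product using (Σ; ∃-syntax; _×_; _,_; proj₁; proj₂; uncurry)
open import Data.Product.Properties using (,-injectiveˡ; ,-injectiveʳ)
open import Data.Rational as ℚ using (_/_)
import Data.Rational.Properties as ℚ
open import Data.Rational.Unnormalised as ℚᵘ using (mkℚᵘ)
import Data.Rational.Unnormalised.Properties as ℚᵘ
open import Data.Refinement using (Refinement-syntax; value)
import Data.Refinement as Refinement
open import Data.Irrelevant using ([_])
open import Data.Sum as Sum using (_⊎_; inj₁; inj₂)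
open import Data.Sum.Properties using (inj₁-injective; inj₂-injective)
open import Data.Unit using (tt)
open import Data.Vec.Functional using () renaming (_∷_ to _∷ᵛ_)
open import Function using (_∘_; id)
open import Function.Bundles using (Injection; Equivalence; _⇔_; mk⇔; mk↣; mk↔ₛ′)
open import Function.Construct.Composition using () renaming (injection to _↣-∘_)
open import Function.Definitions using (Injective)
open import Function.Properties.Inverse using (Inverse⇒Injection)
open import Relation.Binary.Definitions using (tri<; tri≈; tri>)
open import Relation.Binary.PropositionalEquality
open import Relation.Nullary using (¬_; Dec; yes; no; contradiction; recompute)
open import Relation.Nullary.Decidable using (toWitness; _×-dec_; _⊎-dec_; _→-dec_; ¬?)
open import Relation.Unary using (Decidable)

-- Subgraphs

⊑-trans : ∀ {U V W} {F : Graph U} {G : Graph V} {H : Graph W} → F ⊑ G → G ⊑ H → F ⊑ H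
⊑-trans p q = record
  { vertices = _⊑_.vertices p ↣-∘ _⊑_.vertices q
  ; edges    = λ u v a → _⊑_.edges q _ _ (_⊑_.edges p u v a)
  }

-- Along `suc` this deletes the vertex `zero`; along `side` it numbers the vertices of `K 3 3`.
pullback : ∀ {V W : Set} → (V → W) → Graph W → Graph V
pullback f G = record
  { _~_      = λ u v → Adj G (f u) (f v)
  ; _~?_     = λ u v → adj? G (f u) (f v)
  ; ~-sym    = Graph.~-sym G
  ; ~-irrefl = λ { refl → Graph.~-irrefl G refl }
  }

attach : ∀ {n} → Graph (Fin n) → {S : Fin n → Set} → Decidable S → Graph (Fin (suc n))
attach {n} G {S} S? = record
  { _~_ = adj ; _~?_ = dec ; ~-sym = λ {u v} → symm u v ; ~-irrefl = λ { {u} refl → irr u } }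
  where
  adj : Fin (suc n) → Fin (suc n) → Set
  adj zero    zero    = ⊥
  adj zero    (suc v) = S v
  adj (suc u) zero    = S u
  adj (suc u) (suc v) = Adj G u v

  dec : ∀ u v → Dec (adj u v)
  dec zero    zero    = no λ ()
  dec zero    (suc v) = S? v
  dec (suc u) zero    = S? u
  dec (suc u) (suc v) = adj? G u v

  symm : ∀ u v → adj u v → adj v u
  symm zero    (suc v) s = s
  symm (suc u) zero    s = s
  symm (suc u) (suc v) a = Graph.~-sym G a

  irr : ∀ u → ¬ adj u u
  irr (suc u) a = Graph.~-irrefl G refl a

⊑-attach : ∀ {n} (G : Graph (Fin n)) {S : Fin n → Set} (S? : Decidable S) → G ⊑ attach G S?
⊑-attach G S? = record { vertices = mk↣ suc-injective ; edges = λ _ _ a → a }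

isolated : ∀ {n} → Graph (Fin n) → Graph (Fin (suc n))
isolated G = attach G {λ _ → ⊥} (λ _ → no λ ())

-- Density

-- Every dart (ordered pair of adjacent vertices) is charged to one of its two
-- endpoints, and each vertex receives at most d darts.
record Charging {V : Set} (G : Graph V) (d : ℕ) : Set where
  field
    toFirst : V → V → Bool
    slot    : V → V → Fin d

  payer : V → V → V
  payer u v = if toFirst u v then u else v

  field
    distinct : ∀ {u v u′ v′} → Adj G u v → Adj G u′ v′ →
               payer u v ≡ payer u′ v′ → slot u v ≡ slot u′ v′ → u ≡ u′ × v ≡ v′

-- An embedding is injective and commutes with the choice of payer, so charges pulled back along it
-- stay distinct. One charging of a graph thereby bounds the density of all its subgraphs.
charging-⊑ : ∀ {V W d} {H : Graph V} {G : Graph W} → H ⊑ G → Charging G d → Charging H d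
charging-⊑ {H = H} H⊑G C = record
  { toFirst  = λ u v → C.toFirst (f u) (f v)
  ; slot     = λ u v → C.slot (f u) (f v)
  ; distinct = λ {u} {v} {u′} {v′} a a′ p s →
      let fp = trans (sym (if-float f (C.toFirst (f u) (f v))))
                     (trans (cong f p) (if-float f (C.toFirst (f u′) (f v′))))
          u≡ , v≡ = C.distinct (_⊑_.edges H⊑G _ _ a) (_⊑_.edges H⊑G _ _ a′) fp s
      in f-injective u≡ , f-injective v≡
  }
  where
  module C = Charging C
  open Injection (_⊑_.vertices H⊑G) using () renaming (to to f; injective to f-injective)

-- Both darts at the new vertex are charged to it.
charging-attach : ∀ {n d} {G : Graph (Fin n)} {S : Fin n → Set} (S? : Decidable S) →
                  (∀ {u v} → S u → S v → u ≡ v) →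
                  Charging G (2 + d) → Charging (attach G S?) (2 + d)
charging-attach {n} {d} {G} S? S-unique C = record
  { toFirst = first ; slot = slot ; distinct = λ {u v u′ v′} → distinct u v u′ v′ }
  where
  module C = Charging C

  first : Fin (suc n) → Fin (suc n) → Bool
  first zero    _       = true
  first (suc u) zero    = false
  first (suc u) (suc v) = C.toFirst u v

  slot : Fin (suc n) → Fin (suc n) → Fin (2 + d)
  -- Slot `0F` takes the dart leaving the new vertex and `1F` the one entering it; `S-unique` leaves
  -- at most one of each.
  slot zero    _       = 0F
  slot (suc u) zero    = 1F
  slot (suc u) (suc v) = C.slot u v

  payer : Fin (suc n) → Fin (suc n) → Fin (suc n)
  payer u v = if first u v then u else v

  payer-suc : ∀ u v → payer (suc u) (suc v) ≡ suc (C.payer u v)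
  payer-suc u v = sym (if-float suc (C.toFirst u v))

  payer-suc≢0 : ∀ u v → payer (suc u) (suc v) ≢ zero
  payer-suc≢0 u v e with () ← trans (sym (payer-suc u v)) e

  distinct : ∀ u v u′ v′ → Adj (attach G S?) u v → Adj (attach G S?) u′ v′ →
             payer u v ≡ payer u′ v′ → slot u v ≡ slot u′ v′ → u ≡ u′ × v ≡ v′
  distinct zero    (suc v) zero     (suc v′) s s′ _ _ = refl , cong suc (S-unique s s′)
  distinct (suc u) zero    (suc u′) zero     s s′ _ _ = cong suc (S-unique s s′) , refl
  distinct zero    (suc v) (suc u′) zero     _ _ _ ()
  distinct (suc u) zero    zero     (suc v′) _ _ _ ()
  distinct zero    (suc v) (suc u′) (suc v′) _ _ e _ = contradiction (sym e) (payer-suc≢0 u′ v′)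
  distinct (suc u) zero    (suc u′) (suc v′) _ _ e _ = contradiction (sym e) (payer-suc≢0 u′ v′)
  distinct (suc u) (suc v) zero     (suc v′) _ _ e _ = contradiction e (payer-suc≢0 u v)
  distinct (suc u) (suc v) (suc u′) zero     _ _ e _ = contradiction e (payer-suc≢0 u v)
  distinct (suc u) (suc v) (suc u′) (suc v′) a a′ e s =
    let e′ = suc-injective (trans (sym (payer-suc u v)) (trans e (payer-suc u′ v′)))
        u≡ , v≡ = C.distinct a a′ e′ s
    in cong suc u≡ , cong suc v≡

-- Each dart is charged to its first vertex, and the index of the second vertex within the opposite
-- side serves as its slot.
charging-K : ∀ d → Charging (K d d) d
charging-K d = record
  { toFirst  = λ _ _ → true
  ; slot     = λ _ v → Sum.reduce v
  ; distinct = λ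
      { {inj₁ _} {inj₂ _} {inj₁ _} {inj₂ _} _ _ u≡ s≡ → u≡ , cong inj₂ s≡
      ; {inj₂ _} {inj₁ _} {inj₂ _} {inj₁ _} _ _ u≡ s≡ → u≡ , cong inj₁ s≡
      ; {inj₁ _} {inj₂ _} {inj₂ _} {inj₁ _} _ _ ()
      ; {inj₂ _} {inj₁ _} {inj₁ _} {inj₂ _} _ _ ()
      }
  }

Unique-lookup-injective : ∀ {A : Set} {xs : List A} → Unique xs → Injective _≡_ _≡_ (lookup xs)
Unique-lookup-injective (_ ∷ _)  {zero}  {zero}  _ = refl
Unique-lookup-injective (p ∷ _)  {zero}  {suc j} e = contradiction e (All.lookup p (∈-lookup j))
Unique-lookup-injective (p ∷ _)  {suc i} {zero}  e = contradiction (sym e) (All.lookup p (∈-lookup i))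
Unique-lookup-injective (_ ∷ ps) {suc i} {suc j} e = cong suc (Unique-lookup-injective ps e)

module _ {n : ℕ} (G : Graph (Fin n)) where

  private
    ordered? : Decidable λ ((u , v) : Fin n × Fin n) → u Fin.< v × Adj G u v
    ordered? (u , v) = (u Fin.<? v) ×-dec adj? G u v

  edgeList-unique : Unique (edgeList G)
  edgeList-unique =
    Unique.filter⁺ ordered? (Unique.cartesianProduct⁺ (Unique.allFin⁺ n) (Unique.allFin⁺ n))

  edge : Fin (∣E∣ G) → Fin n × Fin n
  edge = lookup (edgeList G)

  edge-ordered : ∀ e → proj₁ (edge e) Fin.< proj₂ (edge e) × Adj G (proj₁ (edge e)) (proj₂ (edge e))
  edge-ordered e = All.lookup (All.all-filter ordered? (List.cartesianProduct (allFin n) (allFin n))) (∈-lookup e)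

  dart : Fin 2 × Fin (∣E∣ G) → Fin n × Fin n
  dart (zero  , e) = edge e
  dart (suc _ , e) = proj₂ (edge e) , proj₁ (edge e)

  dart-adj : ∀ x → uncurry (Adj G) (dart x)
  dart-adj (zero  , e) = proj₂ (edge-ordered e)
  dart-adj (suc _ , e) = Graph.~-sym G (proj₂ (edge-ordered e))

  -- Listed edges have their smaller endpoint first, so a listed edge never equals a reversed one.
  dart-injective : Injective _≡_ _≡_ dart
  dart-injective {0F , e} {0F , e′} eq = cong (0F ,_) (Unique-lookup-injective edgeList-unique eq)
  dart-injective {1F , e} {1F , e′} eq = cong (1F ,_) (Unique-lookup-injective edgeList-unique
    (cong₂ _,_ (,-injectiveʳ eq) (,-injectiveˡ eq)))
  dart-injective {0F , e} {1F , e′} eq = ⊥-elim (ℕ.<-asym (proj₁ (edge-ordered e′))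
    (subst₂ Fin._<_ (,-injectiveˡ eq) (,-injectiveʳ eq) (proj₁ (edge-ordered e))))
  dart-injective {1F , e} {0F , e′} eq = ⊥-elim (ℕ.<-asym (proj₁ (edge-ordered e))
    (subst₂ Fin._<_ (sym (,-injectiveˡ eq)) (sym (,-injectiveʳ eq)) (proj₁ (edge-ordered e′))))

  -- Pigeonhole: payer and slot together embed the `2 * ∣E∣ G` darts into the `n * d` pairs of a
  -- vertex and a slot.
  handshake : ∀ {d} → Charging G d → 2 * ∣E∣ G ≤ n * d
  handshake {d} C = injective⇒≤ {f = λ x → charge (dart (remQuot (∣E∣ G) x))} λ {x} {y} eq →
    remQuot-injective x y (charge-injective _ _ eq)
    where
    open Charging C

    charge : Fin n × Fin n → Fin (n * d)
    charge (u , v) = combine (payer u v) (slot u v)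

    charge-injective : ∀ x y → charge (dart x) ≡ charge (dart y) → x ≡ y
    charge-injective x y eq =
      let p , s = combine-injective _ _ _ _ eq
          u , v = distinct (dart-adj x) (dart-adj y) p s
      in dart-injective (cong₂ _,_ u v)

    remQuot-injective : ∀ x y → remQuot {2} (∣E∣ G) x ≡ remQuot (∣E∣ G) y → x ≡ y
    remQuot-injective x y eq = trans (sym (combine-remQuot {2} (∣E∣ G) x))
      (trans (cong (uncurry combine) eq) (combine-remQuot {2} (∣E∣ G) y))

-- Passing to unnormalised rationals avoids the reduction to lowest terms; cross-multiplying there
-- leaves exactly `handshake`.
averageDegree≤ : ∀ {k d} (H : Graph (Fin (suc k))) → Charging H d → averageDegree H ℚ.≤ + d / 1
averageDegree≤ {k} {d} H C = ℚ.toℚᵘ-cancel-≤ (begin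
  ℚ.toℚᵘ (averageDegree H)      ≃⟨ ℚ.toℚᵘ-fromℚᵘ (mkℚᵘ (+ (2 * ∣E∣ H)) k) ⟩
  mkℚᵘ (+ (2 * ∣E∣ H)) k        ≤⟨ ℚᵘ.*≤* cross ⟩
  mkℚᵘ (+ d) 0                  ≃⟨ ℚ.toℚᵘ-fromℚᵘ (mkℚᵘ (+ d) 0) ⟨
  ℚ.toℚᵘ (+ d / 1)              ∎)
  where
  open ℚᵘ.≤-Reasoning
  cross : + (2 * ∣E∣ H) ℤ.* + 1 ℤ.≤ + d ℤ.* + suc k
  cross rewrite ℤ.*-identityʳ (+ (2 * ∣E∣ H)) | sym (ℤ.pos-* d (suc k)) | ℕ.*-comm d (suc k)
    = ℤ.+≤+ (handshake H C)

-- Degrees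

MaxDegree : ∀ {n} → Graph (Fin n) → ℕ → Set
MaxDegree G d = (∀ v → degree G v ≤ d) × ∃[ v ] degree G v ≡ d

Δ≡ : ∀ {n d} (G : Graph (Fin n)) → MaxDegree G d → Δ G ≡ d
Δ≡ {n} G (bound , v , refl) =
  max≈v⁺ (∈-map⁺ (degree G) (∈-allFin v)) (All.map⁺ (All.universal bound (allFin n))) z≤n

length-filter-map : ∀ {A B : Set} {P : B → Set} (P? : Decidable P) (f : A → B) xs →
                    length (filter P? (map f xs)) ≡ length (filter (P? ∘ f) xs)
length-filter-map P? f [] = refl
length-filter-map P? f (x ∷ xs) with P? (f x)
... | yes _ = cong suc (length-filter-map P? f xs)
... | no  _ = length-filter-map P? f xs

length-filter-tabulate-suc : ∀ {n} {P : Fin (suc n) → Set} (P? : Decidable P) →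
                             length (filter P? (tabulate suc)) ≡ length (filter (P? ∘ suc) (allFin n))
length-filter-tabulate-suc {n} P? =
  trans (cong (length ∘ filter P?) (sym (map-tabulate id suc))) (length-filter-map P? suc (allFin n))

degree-isolated-suc : ∀ {n} (G : Graph (Fin n)) v → degree (isolated G) (suc v) ≡ degree G v
degree-isolated-suc G v = length-filter-tabulate-suc (adj? (isolated G) (suc v))

degree-isolated-zero : ∀ {n} (G : Graph (Fin n)) → degree (isolated G) zero ≡ 0
degree-isolated-zero {n} G = trans (length-filter-tabulate-suc (adj? (isolated G) zero)) (none (allFin n))
  where
  none : ∀ (xs : List (Fin n)) → length (filter {P = λ _ → ⊥} (λ _ → no λ ()) xs) ≡ 0
  none []       = refl
  none (_ ∷ xs) = none xs

MaxDegree-isolated : ∀ {n d} (G : Graph (Fin n)) → MaxDegree G d → MaxDegree (isolated G) d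
MaxDegree-isolated {n} {d} G (bound , v , e) = bound′ , suc v , trans (degree-isolated-suc G v) e
  where
  bound′ : ∀ v → degree (isolated G) v ≤ d
  bound′ zero    rewrite degree-isolated-zero G = z≤n
  bound′ (suc v) rewrite degree-isolated-suc G v = bound v

-- Linear forests from vertex orders

-- An enumeration of the vertices satisfying P by the vertices of a disjoint
-- union of paths.  The first path, if there is one, starts at the least vertex
-- satisfying P: a new least vertex can then only be joined to the start of that path.
record Layout {n : ℕ} (G : Graph (Fin n)) (P : Fin n → Set) : Set where
  field
    {m}        : ℕ
    ℓ          : Fin m → ℕ
    at         : Σ (Fin m) (λ i → Fin (suc (ℓ i))) → Fin n
    at-∈       : ∀ x → P (at x)
    injective  : ∀ x y → at x ≡ at y → x ≡ y
    surjective : ∀ v → P v → ∃[ x ] at x ≡ v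
    edges      : ∀ x y → Adj G (at x) (at y) ⇔ Adj (⨆ (λ i → Path (suc (ℓ i)))) x y
    least      : ∀ i → toℕ i ≡ 0 → ∀ v → P v → at (i , zero) Fin.≤ v

layout⇒forest : ∀ {n} {G : Graph (Fin n)} {P : Fin n → Set} → Decidable P →
                Layout G P → LinearForest (induced G P)
layout⇒forest {n} {G} {P} P? L = m , ℓ , record
  { vertices = mk↔ₛ′ to from (λ x → injective _ _ (at-to (from x))) (λ r → Refinement.value-injective (at-to r))
  ; edges    = λ r s → mk⇔
      (λ a → Equivalence.to (edges _ _) (subst₂ (Adj G) (sym (at-to r)) (sym (at-to s)) a))
      (λ a → subst₂ (Adj G) (at-to r) (at-to s) (Equivalence.from (edges _ _) a))
  }
  where
  open Layout L

  position : (r : [ v ∈ Fin n ∣ P v ]) → ∃[ x ] at x ≡ value r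
  -- Membership in the induced subgraph is irrelevant, so a usable proof of it is recovered by
  -- deciding `P`.
  position (v Refinement., [ p ]) = surjective v (recompute (P? v) p)

  to = proj₁ ∘ position

  at-to : ∀ r → at (to r) ≡ value r
  at-to = proj₂ ∘ position

  from : Σ (Fin m) (λ i → Fin (suc (ℓ i))) → [ v ∈ Fin n ∣ P v ]
  from x = at x Refinement., [ at-∈ x ]

layout-skip : ∀ {n} {G : Graph (Fin (suc n))} {P : Fin (suc n) → Set} →
              ¬ P zero → Layout (pullback suc G) (P ∘ suc) → Layout G P
layout-skip ¬p L = record
  { ℓ          = ℓ
  ; at         = suc ∘ at
  ; at-∈       = at-∈
  ; injective  = λ x y e → injective x y (suc-injective e)
  ; surjective = λ
      { zero    p → contradiction p ¬p
      ; (suc v) p → let x , e = surjective v p in x , cong suc e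
      }
  ; edges      = edges
  ; least      = λ
      { i e zero    p → contradiction p ¬p
      ; i e (suc v) p → s≤s (least i e v p)
      }
  }
  where open Layout L

-- Having no neighbour in `P`, the vertex `zero` forms a path of its own. It goes in front of the
-- other paths to preserve `least`.
layout-new : ∀ {n} {G : Graph (Fin (suc n))} {P : Fin (suc n) → Set} → P zero →
             (∀ v → P (suc v) → ¬ Adj G zero (suc v)) →
             Layout (pullback suc G) (P ∘ suc) → Layout G P
layout-new {n} {G} {P} p0 ¬adj L = record
  { ℓ = ℓ′ ; at = at′ ; at-∈ = ∈′ ; injective = injective′ ; surjective = surjective′
  ; edges = λ x y → mk⇔ (edges-to x y) (edges-from x y) ; least = λ { zero _ _ _ → z≤n } }
  where
  open Layout L
  ℓ′ = 0 ∷ᵛ ℓ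

  Vertex = Σ (Fin (suc m)) λ i → Fin (suc (ℓ′ i))

  at′ : Vertex → Fin (suc n)
  at′ (zero  , _) = zero
  at′ (suc i , x) = suc (at (i , x))

  ∈′ : ∀ x → P (at′ x)
  ∈′ (zero  , _) = p0
  ∈′ (suc i , x) = at-∈ (i , x)

  injective′ : ∀ x y → at′ x ≡ at′ y → x ≡ y
  injective′ (zero  , 0F) (zero  , 0F) _ = refl
  injective′ (suc i , x) (suc j , y) e with refl ← injective (i , x) (j , y) (suc-injective e) = refl

  surjective′ : ∀ v → P v → ∃[ x ] at′ x ≡ v
  surjective′ zero    _ = (zero , zero) , refl
  surjective′ (suc v) p with (i , x) , e ← surjective v p = (suc i , x) , cong suc e

  ⨆′ = ⨆ λ i → Path (suc (ℓ′ i))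

  edges-to : ∀ x y → Adj G (at′ x) (at′ y) → Adj ⨆′ x y
  edges-to (zero  , _) (zero  , _) a = contradiction a (Graph.~-irrefl G refl)
  edges-to (zero  , _) (suc j , y) a = contradiction a (¬adj _ (at-∈ (j , y)))
  edges-to (suc i , x) (zero  , _) a = contradiction (Graph.~-sym G a) (¬adj _ (at-∈ (i , x)))
  edges-to (suc i , x) (suc j , y) a with within b ← Equivalence.to (edges (i , x) (j , y)) a = within b

  edges-from : ∀ x y → Adj ⨆′ x y → Adj G (at′ x) (at′ y)
  edges-from (zero  , 0F) (.zero , 0F) (within (inj₁ ()))
  edges-from (zero  , 0F) (.zero , 0F) (within (inj₂ ()))
  edges-from (suc i , x) (.(suc i) , y) (within b) = Equivalence.from (edges (i , x) (i , y)) (within b)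

-- The vertex `zero` is put before the start of the first path, its only neighbour in `P`. An index
-- `i₀` of value 0 names that path, since the number of paths is a field of `L` and not visibly
-- positive.
layout-extend : ∀ {n} {G : Graph (Fin (suc n))} {P : Fin (suc n) → Set} → P zero →
                (L : Layout (pullback suc G) (P ∘ suc)) → (i₀ : Fin (Layout.m L)) → toℕ i₀ ≡ 0 →
                Adj G zero (suc (Layout.at L (i₀ , zero))) →
                (∀ v → P (suc v) → Adj G zero (suc v) → v ≡ Layout.at L (i₀ , zero)) →
                Layout G P
layout-extend {n} {G} {P} p0 L@record{m = suc m; ℓ = ℓ} zero _ adj₀ unique = record
  { ℓ = ℓ′ ; at = at′ ; at-∈ = ∈′ ; injective = injective′ ; surjective = surjective′
  ; edges = λ x y → mk⇔ (edges-to x y) (edges-from x y) ; least = λ { zero _ _ _ → z≤n } }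
  where
  open Layout L hiding (m; ℓ)
  ℓ′ = suc (ℓ zero) ∷ᵛ (ℓ ∘ suc)

  Vertex = Σ (Fin (suc m)) λ i → Fin (suc (ℓ′ i))

  at′ : Vertex → Fin (suc n)
  at′ (zero  , zero)  = zero
  at′ (zero  , suc x) = suc (at (zero , x))
  at′ (suc i , x)     = suc (at (suc i , x))

  ∈′ : ∀ x → P (at′ x)
  ∈′ (zero  , zero)  = p0
  ∈′ (zero  , suc x) = at-∈ (zero , x)
  ∈′ (suc i , x)     = at-∈ (suc i , x)

  shift : Σ (Fin (suc m)) (λ i → Fin (suc (ℓ i))) → Vertex
  shift (zero  , x) = zero , suc x
  shift (suc i , x) = suc i , x

  at′-shift : ∀ x → at′ (shift x) ≡ suc (at x)
  at′-shift (zero  , x) = refl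
  at′-shift (suc i , x) = refl

  injective′ : ∀ x y → at′ x ≡ at′ y → x ≡ y
  injective′ (zero  , zero)  (zero  , zero)  _ = refl
  injective′ (zero  , suc x) (zero  , suc y) e = cong shift (injective (zero , x) (zero , y) (suc-injective e))
  injective′ (zero  , suc x) (suc j , y)     e = cong shift (injective (zero , x) (suc j , y) (suc-injective e))
  injective′ (suc i , x)     (zero  , suc y) e = cong shift (injective (suc i , x) (zero , y) (suc-injective e))
  injective′ (suc i , x)     (suc j , y)     e = cong shift (injective (suc i , x) (suc j , y) (suc-injective e))

  surjective′ : ∀ v → P v → ∃[ x ] at′ x ≡ v
  surjective′ zero    _ = (zero , zero) , refl
  surjective′ (suc v) p with x , e ← surjective v p = shift x , trans (at′-shift x) (cong suc e)

  ⨆ᴸ = ⨆ λ i → Path (suc (ℓ i))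
  ⨆′ = ⨆ λ i → Path (suc (ℓ′ i))

  shift-adj : ∀ {x y} → Adj ⨆ᴸ x y → Adj ⨆′ (shift x) (shift y)
  shift-adj {zero  , x} (within b) = within (Sum.map (cong suc) (cong suc) b)
  shift-adj {suc i , x} (within b) = within b

  start-to : ∀ x → Adj G zero (at′ x) → Adj ⨆′ (zero , zero) x
  start-to (zero  , zero)  a = contradiction a (Graph.~-irrefl G refl)
  start-to (zero  , suc x) a with refl ← injective (zero , x) (zero , zero) (unique _ (at-∈ (zero , x)) a)
    = within (inj₁ refl)
  start-to (suc i , x)     a with () ← injective (suc i , x) (zero , zero) (unique _ (at-∈ (suc i , x)) a)

  start-from : ∀ x → Adj ⨆′ (zero , zero) x → Adj G zero (at′ x)
  start-from (zero , zero)        (within (inj₁ ()))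
  start-from (zero , zero)        (within (inj₂ ()))
  start-from (zero , suc zero)    (within _) = adj₀
  start-from (zero , suc (suc x)) (within (inj₁ ()))
  start-from (zero , suc (suc x)) (within (inj₂ ()))

  edges-to : ∀ x y → Adj G (at′ x) (at′ y) → Adj ⨆′ x y
  edges-to (zero  , zero)  y               a = start-to y a
  edges-to x@(zero , suc _) (zero , zero)  a = Graph.~-sym ⨆′ (start-to x (Graph.~-sym G a))
  edges-to x@(suc _ , _)    (zero , zero)  a = Graph.~-sym ⨆′ (start-to x (Graph.~-sym G a))
  edges-to (zero  , suc x) (zero  , suc y) a = shift-adj (Equivalence.to (edges (zero , x) (zero , y)) a)
  edges-to (zero  , suc x) (suc j , y)     a = shift-adj (Equivalence.to (edges (zero , x) (suc j , y)) a)
  edges-to (suc i , x)     (zero  , suc y) a = shift-adj (Equivalence.to (edges (suc i , x) (zero , y)) a)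
  edges-to (suc i , x)     (suc j , y)     a = shift-adj (Equivalence.to (edges (suc i , x) (suc j , y)) a)

  edges-from : ∀ x y → Adj ⨆′ x y → Adj G (at′ x) (at′ y)
  edges-from (zero , zero)  y a = start-from y a
  edges-from x@(zero , suc _) (zero , zero) a = Graph.~-sym G (start-from x (Graph.~-sym ⨆′ a))
  edges-from (zero , suc x) (.zero , suc y) (within b) =
    Equivalence.from (edges (zero , x) (zero , y)) (within (Sum.map ℕ.suc-injective ℕ.suc-injective b))
  edges-from (suc i , x) (.(suc i) , y) (within b) = Equivalence.from (edges (suc i , x) (suc i , y)) (within b)

Consecutive : ∀ {n} → Graph (Fin n) → (Fin n → Set) → Set
Consecutive G P = ∀ {u v w} → u Fin.< v → v Fin.< w → P u → P v → P w → ¬ Adj G u w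

-- Vertices are added from the greatest to the least. If `zero` were adjacent to a vertex of `P`
-- beyond `first`, then `first` would lie strictly between them, against `Consecutive`. So a new
-- vertex of `P` either extends the first path or starts another.
layout : ∀ {n} (G : Graph (Fin n)) {P : Fin n → Set} → Decidable P → Consecutive G P → Layout G P
layout {zero}  G P? c = record
  { m = 0 ; ℓ = λ () ; at = λ () ; at-∈ = λ () ; injective = λ () ; surjective = λ () ; edges = λ () ; least = λ () }
layout {suc n} G {P} P? c with P? zero | layout (pullback suc G) (P? ∘ suc) (λ u<v v<w → c (s≤s u<v) (s≤s v<w))
... | no ¬p | L = layout-skip ¬p L
-- Without paths there is no later vertex in `P`, as it would have to lie on one of them.
... | yes p | L@record{m = zero} =
  layout-new p (λ v q → let (i , _) , _ = Layout.surjective L v q in contradiction i ¬Fin0) L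
... | yes p | L@record{m = suc _} with adj? G zero (suc (Layout.at L (zero , zero)))
...   | yes a = layout-extend p L zero refl a λ v q b → only v q b
  where
  first = Layout.at L (zero , zero)
  only : ∀ v → P (suc v) → Adj G zero (suc v) → v ≡ first
  only v q b with <-cmp first v
  ... | tri< f<v _ _ = contradiction b (c (s≤s z≤n) (s≤s f<v) p (Layout.at-∈ L _) q)
  ... | tri≈ _ f≡v _ = sym f≡v
  ... | tri> _ _ v<f = contradiction (Layout.least L zero refl v q) (ℕ.<⇒≱ v<f)
...   | no ¬a = layout-new p none L
  where
  first = Layout.at L (zero , zero)
  none : ∀ v → P (suc v) → ¬ Adj G zero (suc v)
  none v q b with <-cmp first v
  ... | tri< f<v _ _ = c (s≤s z≤n) (s≤s f<v) p (Layout.at-∈ L _) q b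
  ... | tri≈ _ refl _ = ¬a b
  ... | tri> _ _ v<f = contradiction (Layout.least L zero refl v q) (ℕ.<⇒≱ v<f)

-- The vertices of any two color classes, taken in increasing order, fall into
-- paths because no third vertex of these colors separates the ends of an edge.
record OrderedColoring {n : ℕ} (G : Graph (Fin n)) (k : ℕ) : Set where
  field
    color  : Fin n → Fin k
    proper : ∀ u v → Adj G u v → color u ≢ color v
    gap    : ∀ u v w → u Fin.< v → v Fin.< w → Adj G u w → color v ≢ color u × color v ≢ color w

-- The ends of an edge and a vertex between them have three different colors, by `proper` and `gap`,
-- so they cannot all lie in two color classes.
ordered⇒linear : ∀ {n k} {G : Graph (Fin n)} → OrderedColoring G k → LinearColoring G k
ordered⇒linear {G = G} O = record
  { color  = color
  ; proper = proper
  ; linear = λ a b _ →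
      let P? = λ v → (color v ≟ a) ⊎-dec (color v ≟ b)
      in layout⇒forest P? (layout G P? λ u<v v<w pu pv pw adj →
           let v≢u , v≢w = gap _ _ _ u<v v<w adj
           in three pu pv pw v≢u v≢w (proper _ _ adj))
  }
  where
  open OrderedColoring O

  three : ∀ {A : Set} {a b x y z : A} → x ≡ a ⊎ x ≡ b → y ≡ a ⊎ y ≡ b → z ≡ a ⊎ z ≡ b →
          y ≢ x → y ≢ z → x ≢ z → ⊥
  three (inj₁ refl) (inj₁ refl) _           y≢x _   _   = y≢x refl
  three (inj₂ refl) (inj₂ refl) _           y≢x _   _   = y≢x refl
  three (inj₁ refl) (inj₂ refl) (inj₁ refl) _   _   x≢z = x≢z refl
  three (inj₁ refl) (inj₂ refl) (inj₂ refl) _   y≢z _   = y≢z refl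
  three (inj₂ refl) (inj₁ refl) (inj₁ refl) _   y≢z _   = y≢z refl
  three (inj₂ refl) (inj₁ refl) (inj₂ refl) _   _   x≢z = x≢z refl

-- The new vertex lies on no edge and, coming first, between the ends of none. Any color suits it,
-- and `suc k` guarantees that one exists.
ordered-isolated : ∀ {n k} {G : Graph (Fin n)} → OrderedColoring G (suc k) → OrderedColoring (isolated G) (suc k)
ordered-isolated O = record
  { color  = zero ∷ᵛ color
  ; proper = λ { zero zero () ; zero (suc v) () ; (suc u) zero () ; (suc u) (suc v) → proper u v }
  ; gap    = λ
      { zero    (suc v) (suc w) _         _         ()
      ; (suc u) (suc v) (suc w) (s≤s u<v) (s≤s v<w) → gap u v w u<v v<w
      }
  }
  where open OrderedColoring O

-- The lower bound

-- The two neighbours are the predecessor and the successor of `x`, in one order or the other. Their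
-- sum hides which is which, so the uses below need no case distinction.
Path-neighbours : ∀ {n} {x p q : Fin n} → Adj (Path n) x p → Adj (Path n) x q → p ≢ q →
                  toℕ p + toℕ q ≡ toℕ x + toℕ x
Path-neighbours (inj₁ e) (inj₁ f) p≢q = contradiction (toℕ-injective (trans (sym e) f)) p≢q
Path-neighbours (inj₂ e) (inj₂ f) p≢q = contradiction (toℕ-injective (ℕ.suc-injective (trans e (sym f)))) p≢q
Path-neighbours {q = q} (inj₁ e) (inj₂ f) _ rewrite sym e | sym f = sym (ℕ.+-suc (suc (toℕ q)) (toℕ q))
Path-neighbours {p = p} (inj₂ e) (inj₁ f) _ rewrite sym f | sym e = ℕ.+-suc (toℕ p) (suc (toℕ p))

m+m≡n+n⇒m≡n : ∀ {m n} → m + m ≡ n + n → m ≡ n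
m+m≡n+n⇒m≡n {m} {n} e = ℕ.*-cancelˡ-≡ m n 2
  (trans (cong (_+_ m) (ℕ.+-identityʳ m)) (trans e (cong (_+_ n) (sym (ℕ.+-identityʳ n)))))

module _ {V : Set} (G : Graph V) where

  NoSquare : Set
  NoSquare = ∀ {x y p q} → x ≢ y → p ≢ q →
             Adj G x p → Adj G x q → Adj G y p → Adj G y q → ⊥

  NoClaw : Set
  NoClaw = ∀ {x p q r} → p ≢ q → q ≢ r → p ≢ r → Adj G x p → Adj G x q → Adj G x r → ⊥

module _ {m : ℕ} (ℓ : Fin m → ℕ) where

  private
    F = ⨆ λ i → Path (suc (ℓ i))

  -- Both `x` and `y` would sit at the midpoint of `p` and `q`, hence coincide.
  ⨆Path-noSquare : NoSquare F
  ⨆Path-noSquare {_ , x} {_ , y} x≢y p≢q (within a) (within b) (within c) (within d) =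
    x≢y (cong (_ ,_) (toℕ-injective (m+m≡n+n⇒m≡n (trans (sym (Path-neighbours a b p≢q′)) (Path-neighbours c d p≢q′)))))
    where p≢q′ = p≢q ∘ cong (_ ,_)

  -- The center and the neighbour `p` determine any other neighbour, as the two positions sum to
  -- twice that of the center; so `q` and `r` would coincide.
  ⨆Path-noClaw : NoClaw F
  ⨆Path-noClaw {p = _ , p} p≢q q≢r p≢r (within a) (within b) (within c) =
    q≢r (cong (_ ,_) (toℕ-injective (ℕ.+-cancelˡ-≡ (toℕ p) _ _
      (trans (Path-neighbours a b (p≢q ∘ cong (_ ,_))) (sym (Path-neighbours a c (p≢r ∘ cong (_ ,_))))))))

module _ {V : Set} {G : Graph V} (forest : LinearForest G) where

  private
    ℓ = proj₁ (proj₂ forest)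
    iso = proj₂ (proj₂ forest)
    open Injection (Inverse⇒Injection (_≅_.vertices iso)) using (to; injective)

    adj : ∀ {u v} → Adj G u v → Adj (⨆ λ i → Path (suc (ℓ i))) (to u) (to v)
    adj = Equivalence.to (_≅_.edges iso _ _)

  forest-noSquare : NoSquare G
  forest-noSquare x≢y p≢q a b c d =
    ⨆Path-noSquare ℓ (x≢y ∘ injective) (p≢q ∘ injective) (adj a) (adj b) (adj c) (adj d)

  forest-noClaw : NoClaw G
  forest-noClaw p≢q q≢r p≢r a b c =
    ⨆Path-noClaw ℓ (p≢q ∘ injective) (q≢r ∘ injective) (p≢r ∘ injective) (adj a) (adj b) (adj c)

module _ {V : Set} {G : Graph V} {k : ℕ} (L : LinearColoring G k) where

  open LinearColoring L

  -- The square would survive in the subgraph induced by the classes of `x` and `p`, which are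
  -- distinct by `proper` and so induce a linear forest.
  noBichromaticSquare : ∀ {x y p q} → x ≢ y → p ≢ q → color x ≡ color y → color p ≡ color q →
                        Adj G x p → Adj G x q → Adj G y p → Adj G y q → ⊥
  noBichromaticSquare {x} {y} {p} {q} x≢y p≢q xy pq a b c d =
    forest-noSquare (linear (color x) (color p) (proper x p a))
      {x Refinement., [ inj₁ refl ]} {y Refinement., [ inj₁ (sym xy) ]}
      {p Refinement., [ inj₂ refl ]} {q Refinement., [ inj₂ (sym pq) ]}
      (x≢y ∘ cong value) (p≢q ∘ cong value) a b c d

  noBichromaticClaw : ∀ {x p q r} → p ≢ q → q ≢ r → p ≢ r → color p ≡ color q → color p ≡ color r →
                      Adj G x p → Adj G x q → Adj G x r → ⊥
  noBichromaticClaw {x} {p} {q} {r} p≢q q≢r p≢r pq pr a b c =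
    forest-noClaw (linear (color x) (color p) (proper x p a))
      {x Refinement., [ inj₁ refl ]} {p Refinement., [ inj₂ refl ]}
      {q Refinement., [ inj₂ (sym pq) ]} {r Refinement., [ inj₂ (sym pr) ]}
      (p≢q ∘ cong value) (q≢r ∘ cong value) (p≢r ∘ cong value) a b c

-- The three values of `f` and the two values `g x` and `g y` are pairwise different, which embeds
-- `Fin 5`, split as `Fin 3 ⊎ Fin 2`, into `Fin k`.
five-colors : ∀ {k} (f g : Fin 3 → Fin k) → (∀ x y → f x ≢ g y) →
              Injective _≡_ _≡_ f → ∀ {x y} → g x ≢ g y → 5 ≤ k
five-colors {k} f g f≢g f-inj {x} {y} gx≢gy = injective⇒≤ {f = h ∘ splitAt 3} λ {i} {j} e →
  trans (sym (join-splitAt 3 2 i)) (trans (cong (join 3 2) (h-injective (splitAt 3 i) (splitAt 3 j) e)) (join-splitAt 3 2 j))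
  where
  h : Fin 3 ⊎ Fin 2 → Fin k
  h (inj₁ i)  = f i
  h (inj₂ 0F) = g x
  h (inj₂ 1F) = g y

  h-injective : ∀ i j → h i ≡ h j → i ≡ j
  h-injective (inj₁ i)  (inj₁ j)  e = cong inj₁ (f-inj e)
  h-injective (inj₁ i)  (inj₂ 0F) e = contradiction e (f≢g _ _)
  h-injective (inj₁ i)  (inj₂ 1F) e = contradiction e (f≢g _ _)
  h-injective (inj₂ 0F) (inj₁ j)  e = contradiction (sym e) (f≢g _ _)
  h-injective (inj₂ 1F) (inj₁ j)  e = contradiction (sym e) (f≢g _ _)
  h-injective (inj₂ 0F) (inj₂ 0F) e = refl
  h-injective (inj₂ 0F) (inj₂ 1F) e = contradiction e gx≢gy
  h-injective (inj₂ 1F) (inj₂ 0F) e = contradiction (sym e) gx≢gy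
  h-injective (inj₂ 1F) (inj₂ 1F) e = refl

module _ {V : Set} {k : ℕ} {G : Graph V} (K₃₃⊑G : K 3 3 ⊑ G) (L : LinearColoring G k) where

  private
    open LinearColoring L
    open Injection (_⊑_.vertices K₃₃⊑G) using () renaming (to to ι; injective to ι-injective)

    a b : Fin 3 → V
    a = ι ∘ inj₁
    b = ι ∘ inj₂

    a-injective : ∀ {i j} → a i ≡ a j → i ≡ j
    a-injective = inj₁-injective ∘ ι-injective

    b-injective : ∀ {i j} → b i ≡ b j → i ≡ j
    b-injective = inj₂-injective ∘ ι-injective

    a~b : ∀ i j → Adj G (a i) (b j)
    a~b i j = _⊑_.edges K₃₃⊑G (inj₁ i) (inj₂ j) tt

    b~a : ∀ i j → Adj G (b i) (a j)
    b~a i j = Graph.~-sym G (a~b j i)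

    -- If all three vertices had one color, they would form a bichromatic claw with center `x`.
    not-monochromatic : ∀ x (c : Fin 3 → V) → (∀ {i j} → c i ≡ c j → i ≡ j) → (∀ i → Adj G x (c i)) →
                        ∃[ i ] ∃[ j ] color (c i) ≢ color (c j)
    not-monochromatic x c c-injective x~c with color (c 0F) ≟ color (c 1F) | color (c 0F) ≟ color (c 2F)
    ... | no c₀≢c₁ | _         = 0F , 1F , c₀≢c₁
    ... | yes _    | no c₀≢c₂  = 0F , 2F , c₀≢c₂
    ... | yes c₀≡c₁ | yes c₀≡c₂ = ⊥-elim (noBichromaticClaw L
      ((λ ()) ∘ c-injective {0F} {1F}) ((λ ()) ∘ c-injective {1F} {2F}) ((λ ()) ∘ c-injective {0F} {2F})
      c₀≡c₁ c₀≡c₂ (x~c 0F) (x~c 1F) (x~c 2F))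

  -- If two `a`s share a color, two `b`s sharing one would close a bichromatic square, so the `b`s
  -- are colored injectively; otherwise the `a`s are. The opposite side adds two further colors.
  K₃₃-needs-five-colors : 5 ≤ k
  K₃₃-needs-five-colors with any? (λ i → any? (λ j → ¬? (i ≟ j) ×-dec (color (a i) ≟ color (a j))))
  ... | yes (i , j , i≢j , ai≡aj) =
    let _ , _ , a≢a = not-monochromatic (b 0F) a a-injective (b~a 0F)
    in five-colors (color ∘ b) (color ∘ a) (λ x y → proper _ _ (b~a x y)) b-distinct a≢a
    where
    b-distinct : Injective _≡_ _≡_ (color ∘ b)
    b-distinct {x} {y} bx≡by with x ≟ y
    ... | yes x≡y = x≡y
    ... | no  x≢y = ⊥-elim (noBichromaticSquare L (i≢j ∘ a-injective) (x≢y ∘ b-injective) ai≡aj bx≡by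
                              (a~b i x) (a~b i y) (a~b j x) (a~b j y))
  ... | no ¬repeat =
    let _ , _ , b≢b = not-monochromatic (a 0F) b b-injective (a~b 0F)
    in five-colors (color ∘ a) (color ∘ b) (λ x y → proper _ _ (a~b x y)) a-distinct b≢b
    where
    a-distinct : Injective _≡_ _≡_ (color ∘ a)
    a-distinct {x} {y} ax≡ay with x ≟ y
    ... | yes x≡y = x≡y
    ... | no  x≢y = contradiction (x , y , x≢y , ax≡ay) ¬repeat

-- K₃,₃ with a pendant vertex and isolated vertices

-- The two vertices sharing color 3 below, 0F and 4F, enclose the opposite side, so
-- that each vertex of that side lies between its two neighbours of color 3.
side : Fin 6 → Fin 3 ⊎ Fin 3
side 0F = inj₂ 0F
side 1F = inj₁ 0F
side 2F = inj₁ 1F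
side 3F = inj₁ 2F
side 4F = inj₂ 1F
side 5F = inj₂ 2F

side⁻¹ : Fin 3 ⊎ Fin 3 → Fin 6
side⁻¹ (inj₁ 0F) = 1F
side⁻¹ (inj₁ 1F) = 2F
side⁻¹ (inj₁ 2F) = 3F
side⁻¹ (inj₂ 0F) = 0F
side⁻¹ (inj₂ 1F) = 4F
side⁻¹ (inj₂ 2F) = 5F

side-side⁻¹ : ∀ v → side (side⁻¹ v) ≡ v
side-side⁻¹ (inj₁ 0F) = refl
side-side⁻¹ (inj₁ 1F) = refl
side-side⁻¹ (inj₁ 2F) = refl
side-side⁻¹ (inj₂ 0F) = refl
side-side⁻¹ (inj₂ 1F) = refl
side-side⁻¹ (inj₂ 2F) = refl

side⁻¹-side : ∀ v → side⁻¹ (side v) ≡ v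
side⁻¹-side 0F = refl
side⁻¹-side 1F = refl
side⁻¹-side 2F = refl
side⁻¹-side 3F = refl
side⁻¹-side 4F = refl
side⁻¹-side 5F = refl

K₃₃ : Graph (Fin 6)
K₃₃ = pullback side (K 3 3)

K₃₃⊑K : K₃₃ ⊑ K 3 3
K₃₃⊑K = record
  { vertices = mk↣ {to = side} λ {u} {v} e → trans (sym (side⁻¹-side u)) (trans (cong side⁻¹ e) (side⁻¹-side v))
  ; edges    = λ _ _ a → a
  }

K⊑K₃₃ : K 3 3 ⊑ K₃₃
K⊑K₃₃ = record
  { vertices = mk↣ {to = side⁻¹} λ {u} {v} e → trans (sym (side-side⁻¹ u)) (trans (cong side e) (side-side⁻¹ v))
  ; edges    = λ u v → subst₂ (Adj (K 3 3)) (sym (side-side⁻¹ u)) (sym (side-side⁻¹ v))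
  }

core : Graph (Fin 7)
core = attach K₃₃ (_≟ 1F)

core-MaxDegree : MaxDegree core 4
-- Attaching shifts the old vertices by one, so `2F` is the neighbour of the pendant vertex and has
-- one edge more than the three in `K₃₃`.
core-MaxDegree = toWitness {a? = all? λ v → degree core v ℕ.≤? 4} tt , 2F , refl

core-coloring : OrderedColoring core 5
core-coloring = record
  { color  = c
  ; proper = toWitness {a? = all? λ u → all? λ v → adj? core u v →-dec ¬? (c u ≟ c v)} tt
  ; gap    = toWitness {a? = all? λ u → all? λ v → all? λ w →
      (u Fin.<? v) →-dec ((v Fin.<? w) →-dec (adj? core u w →-dec (¬? (c v ≟ c u) ×-dec ¬? (c v ≟ c w))))} tt
  }
  where
  c : Fin 7 → Fin 5
  -- The pendant vertex must avoid `0F`, the color of its neighbour `2F`, and `3F`, the color of the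
  -- vertex `1F` between them.
  c = 1F ∷ᵛ 3F ∷ᵛ 0F ∷ᵛ 1F ∷ᵛ 2F ∷ᵛ 3F ∷ᵛ 4F ∷ᵛ λ ()

graph : ∀ i → Graph (Fin (i + 7))
graph zero    = core
graph (suc i) = isolated (graph i)

K₃₃⊑graph : ∀ i → K₃₃ ⊑ graph i
K₃₃⊑graph zero    = ⊑-attach K₃₃ _
K₃₃⊑graph (suc i) = ⊑-trans (K₃₃⊑graph i) (⊑-attach (graph i) _)

K⊑graph : ∀ i → K 3 3 ⊑ graph i
K⊑graph i = ⊑-trans K⊑K₃₃ (K₃₃⊑graph i)

-- Three slots suffice for `K₃₃`, and each attached vertex has at most one neighbour, so none of
-- them demands a fourth.
charging : ∀ i → Charging (graph i) 3
charging zero    = charging-attach (_≟ 1F) (λ p q → trans p (sym q)) (charging-⊑ K₃₃⊑K (charging-K 3))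
charging (suc i) = charging-attach _ (λ ()) (charging i)

mad-graph : ∀ i → IsMad (graph i) (+ 3 / 1)
-- The value 3 is attained by `K₃₃`, with `suc 5` vertices and 9 edges: 18/6 reduces to 3 by
-- computation.
mad-graph i = (5 , K₃₃ , K₃₃⊑graph i , refl) , λ H H⊑G → averageDegree≤ H (charging-⊑ H⊑G (charging i))

maxDegree : ∀ i → MaxDegree (graph i) 4
maxDegree zero    = core-MaxDegree
maxDegree (suc i) = MaxDegree-isolated (graph i) (maxDegree i)

coloring : ∀ i → OrderedColoring (graph i) 5
coloring zero    = core-coloring
coloring (suc i) = ordered-isolated (coloring i)

lc-graph : ∀ i → IsLinearChromaticNumber (graph i) 5
lc-graph i = ordered⇒linear (coloring i) , λ _ → K₃₃-needs-five-colors (K⊑graph i)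

mainTheorem2 : Σ (ℕ → ℕ) λ order → Σ ((i : ℕ) → Graph (Fin (order i))) λ G →
    (∀ i j → i ≢ j → ¬ (G i ≅ G j))
    × (∀ i →
    K 3 3 ⊑ G i
    × IsMad (G i) (+ 3 / 1)
    × Δ (G i) ≡ 4
    × ∃[ k ] (IsLinearChromaticNumber (G i) k × k > ⌈ Δ (G i) /2⌉ + 2))
mainTheorem2 = (_+ 7) , graph
  -- Isomorphic graphs have equally many vertices, while the orders `i + 7` are all different.
  , (λ i j i≢j iso → i≢j (ℕ.+-cancelʳ-≡ 7 i j (Permutation.↔⇒≡ (_≅_.vertices iso))))
  , λ i → K⊑graph i , mad-graph i , Δ≡ (graph i) (maxDegree i) , 5 , lc-graph i
        -- At `d = 4` the right-hand side is 2 + 2, and `5 > 4` unfolds to `5 ≤ 5`.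
        , subst (λ d → 5 > ⌈ d /2⌉ + 2) (sym (Δ≡ (graph i) (maxDegree i))) ℕ.≤-refl
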